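{- For every integer $k\ge 2$ there is a constant $B_k$ such that for every graph $G$ on $p$ vertices with $m$ edges and no isolated vertices, \[ r(C_{2k+1},G)\le 2m\left(1+B_k m^{ -1/20}\right)+p. \]
   Context: For graphs $H$ and $G$, the Ramsey number $r(H,G)$ is the least positive integer $N$ such that every red/blue coloring of the edges of the complete graph $K_N$ contains a red copy of $H$ or a blue copy of $G$. $C_{2k+1}$ denotes the cycle on $2k+1$ vertices. -}

module Defs where

open import Data.Nat using (ℕ; zero; suc; _+_; _*_; _∸_; _^_; _≤_; _<_)
open import Data.Nat.Properties using (suc-injective)
import Data.Nat as ℕ
open import Data.Fin using (Fin; zero; suc; toℕ; lower₁)
open import Data.Bool using (Bool; true; false; _∧_)
open import Data.Product using (Σ; ∃; _×_; _,_; proj₁; proj₂)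
open import Data.Sum using (_⊎_)
open import Data.List using (List; []; _∷_; length; filterᵇ)
open import Data.List using (allFin) renaming (cartesianProduct to _⊗_)
open import Relation.Binary.PropositionalEquality using (_≡_; _≢_; refl)
open import Relation.Nullary using (yes; no)
open import Function.Definitions using (Injective)

record SimpleGraph (p : ℕ) : Set where
  field
    Adj   : Fin p → Fin p → Bool
    sym   : ∀ i j → Adj i j ≡ Adj j i
    irrefl : ∀ i → Adj i i ≡ false
open SimpleGraph public

edgeCount : ∀ {p} → SimpleGraph p → ℕ
edgeCount {p} G =
  length (filterᵇ (λ ij → isEdge (proj₁ ij) (proj₂ ij)) (allFin p ⊗ allFin p))
  where
    isEdge : Fin p → Fin p → Bool
    isEdge i j = (toℕ i ℕ.<ᵇ toℕ j) ∧ Adj G i j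

NoIsolatedVertices : ∀ {p} → SimpleGraph p → Set
NoIsolatedVertices {p} G = ∀ (i : Fin p) → ∃ λ (j : Fin p) → Adj G i j ≡ true

-- Red/blue edge colouring of K_N: a symmetric Bool matrix (true = red,
-- false = blue); the diagonal is irrelevant.
Colouring : ℕ → Set
Colouring N = Fin N → Fin N → Bool

SymmetricColouring : ∀ {N} → Colouring N → Set
SymmetricColouring {N} c = ∀ (x y : Fin N) → c x y ≡ c y x

red blue : Bool
red = true
blue = false

next : ∀ {n} → Fin (suc n) → Fin (suc n)
next {n} i with n ℕ.≟ toℕ i
... | yes _ = zero
... | no ne = lower₁ (suc i) (λ eq → ne (suc-injective eq))

-- A copy of the cycle C_n (n = suc l vertices) in colour b: an injective
-- map of the cycle's vertices whose consecutive pairs all have colour b.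
HasCycleCopy : ∀ {N} → Colouring N → Bool → (l : ℕ) → Set
HasCycleCopy {N} c b l =
  Σ (Fin (suc l) → Fin N) λ f → Injective _≡_ _≡_ f × (∀ i → c (f i) (f (next i)) ≡ b)

HasCopy : ∀ {N p} → Colouring N → Bool → SimpleGraph p → Set
HasCopy {N} {p} c b G =
  Σ (Fin p → Fin N) λ f → Injective _≡_ _≡_ f ×
    (∀ i j → Adj G i j ≡ true → c (f i) (f j) ≡ b)

-- Every red/blue colouring of K_N contains a red C_{2k+1} or a blue G.
-- r(C_{2k+1}, G) is the least positive N with this property.
RamseyProp : (k : ℕ) → ∀ {p} → SimpleGraph p → ℕ → Set
RamseyProp k G N = ∀ (c : Colouring N) → SymmetricColouring c →
  HasCycleCopy c red (2 * k) ⊎ HasCopy c blue G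

{-# OPTIONS --safe #-}
module Submission where

-- Let the red graph on N = 2m + p + E vertices, E = C m^(19/20), contain no cycle of length
-- l + 1 = 2k + 1. Embed G into blue one vertex at a time so that the vertex added to a part with
-- n vertices in total has minimum degree δ there, whence n δ ≤ 2m. If it cannot be placed, then
-- the red neighbourhoods of the images of its δ neighbours cover more than 2m + E vertices, so a
-- red degree d satisfies δ d > 2m + E and thus exceeds n by about E / δ. A red neighbourhood
-- contains no red path on l vertices, so it is sparse; without its few vertices of high degree it
-- still has room for a greedy embedding of the whole part, which is √(2m)-degenerate. This works
-- for n > a^12, where a is about m^(1/20). For smaller n there is even a blue complete graph,
-- because the Ramsey number of C_{l+1} and K_n is O(n^(3/2)): the first two spheres around a
-- vertex contain independent sets of linear size, by the Gallai–Roy theorem.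

open import Defs hiding (sym)
open import Data.Bool using (Bool; true; false; _∧_)
import Data.Bool.Properties as Bool
open import Data.Empty using (⊥-elim)
open import Data.Fin using (Fin; zero; suc; toℕ; fromℕ<)
import Data.Fin.Properties as Fin
open import Data.List using (List; []; _∷_; _++_; length; map; filter; filterᵇ; concatMap; cartesianProduct; take; drop; lookup; allFin)
open import Data.List.Membership.Propositional using (_∈_; _∉_; find; lose)
open import Data.List.Membership.Propositional.Properties
  using (∈-∃++; ∈-lookup; ∈-filter⁺; ∈-filter⁻; ∈-++⁺ˡ; ∈-++⁺ʳ; ∈-++⁻; ∈-map⁺; ∈-concatMap⁺; ∈-allFin)
import Data.List.Membership.DecPropositional as DecMembership
open import Data.List.Properties
  using (length-filter; length-++; length-map; length-take; length-drop; length-tabulate; filter-reject; filter-none; map-++; map-∘)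
open import Data.List.Relation.Binary.Permutation.Propositional using (_↭_; ↭-sym; ↭⇒↭ₛ)
open import Data.List.Relation.Binary.Permutation.Propositional.Properties
  using (shift; ↭-length; ∈-resp-↭; All-resp-↭; map⁺; filter-↭)
open import Data.List.Relation.Binary.Permutation.Setoid.Properties using (Unique-resp-↭)
open import Data.List.Relation.Binary.Sublist.Propositional using (_⊆_; []; _∷_; _∷ʳ_; ⊆-trans; minimum; from∈)
open import Data.List.Relation.Binary.Sublist.Propositional.Properties using (All-resp-⊆; Any-resp-⊆)
open import Data.List.Relation.Unary.All as All using (All; []; _∷_)
import Data.List.Relation.Unary.All.Properties as All
open import Data.List.Relation.Unary.AllPairs as AllPairs using (AllPairs; []; _∷_)
import Data.List.Relation.Unary.AllPairs.Properties as AllPairs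
open import Data.List.Relation.Unary.Any as Any using (Any; here; there; any?)
open import Data.List.Relation.Unary.Linked using (Linked; []; [-]; _∷_)
open import Data.List.Relation.Unary.Linked.Properties using (Linked⇒AllPairs)
open import Data.List.Relation.Unary.Unique.Propositional using (Unique)
import Data.List.Relation.Unary.Unique.Propositional.Properties as Unique
import Data.List.Sort
open import Data.Nat
open import Data.Nat.ListAction using (sum)
open import Data.Nat.ListAction.Properties using (sum-↭; sum-++)
open import Data.Nat.Properties
open import Data.Nat.Solver using (module +-*-Solver)
open import Data.Product using (Σ; ∃; ∃₂; _×_; _,_; proj₁; proj₂)
open import Data.Sum using (_⊎_; inj₁; inj₂; [_,_]′; map₁; map₂)
open import Function using (_∘_)
open import Function.Bundles using (Equivalence)
open import Level using (0ℓ)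
open import Relation.Binary as B using (Rel; DecidableEquality; DecTotalOrder; Symmetric)
import Relation.Binary.Construct.On as On
open import Relation.Binary.PropositionalEquality
open import Relation.Nullary using (¬_; Dec; yes; no)
open import Relation.Nullary.Decidable using (¬?; _×-dec_; decidable-stable)
open import Relation.Unary using (Pred; Decidable)

private variable
  A : Set

-- Lists: counting, sums, sublists and linked lists

extract : ∀ {x : A} {xs} → x ∈ xs → ∃ λ ys → xs ↭ x ∷ ys
extract {x = x} x∈xs with ys , zs , refl ← ∈-∃++ x∈xs = ys ++ zs , shift x ys zs

length-mono : ∀ {xs ys : List A} → Unique xs → (∀ {x} → x ∈ xs → x ∈ ys) → length xs ≤ length ys
length-mono {xs = []}     _          _   = z≤n
length-mono {xs = x ∷ xs} (x∉ ∷ uxs) sub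
  with zs , ys↭ ← extract (sub (here refl)) =
  subst (suc (length xs) ≤_) (sym (↭-length ys↭)) (s≤s (length-mono uxs sub′))
  where
  sub′ : ∀ {y} → y ∈ xs → y ∈ zs
  sub′ y∈xs with ∈-resp-↭ ys↭ (sub (there y∈xs))
  ... | here refl = ⊥-elim (All.lookup x∉ y∈xs refl)
  ... | there y∈zs = y∈zs

fresh : DecidableEquality A → ∀ {xs ys : List A} → Unique xs → length ys < length xs →
        ∃ λ x → x ∈ xs × x ∉ ys
fresh _≟ᴬ_ {xs} {ys} uxs ys<xs = decide (any? (λ x → ¬? (x ∈? ys)) xs)
  where
  open DecMembership _≟ᴬ_ using (_∈?_)
  decide : Dec (Any (_∉ ys) xs) → ∃ λ x → x ∈ xs × x ∉ ys
  decide (yes p) = find p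
  decide (no ¬p) = ⊥-elim (<⇒≱ ys<xs (length-mono uxs λ x∈ →
    decidable-stable (_ ∈? ys) (All.lookup (All.¬Any⇒All¬ xs ¬p) x∈)))

length-filter-split : ∀ {P : Pred A 0ℓ} (P? : Decidable P) xs →
                      length xs ≡ length (filter P? xs) + length (filter (¬? ∘ P?) xs)
length-filter-split P? [] = refl
length-filter-split P? (x ∷ xs) with P? x
... | yes _ = cong suc (length-filter-split P? xs)
... | no _ = trans (cong suc (length-filter-split P? xs)) (sym (+-suc _ _))

Σ[_] : List A → (A → ℕ) → ℕ
Σ[ xs ] g = sum (map g xs)

Σ-mono : ∀ (xs : List A) {f g : A → ℕ} → (∀ {x} → x ∈ xs → f x ≤ g x) → Σ[ xs ] f ≤ Σ[ xs ] g
Σ-mono []       f≤g = z≤n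
Σ-mono (x ∷ xs) f≤g = +-mono-≤ (f≤g (here refl)) (Σ-mono xs (f≤g ∘ there))

Σ-const : ∀ (xs : List A) n → Σ[ xs ] (λ _ → n) ≡ length xs * n
Σ-const []       n = refl
Σ-const (x ∷ xs) n = cong (n +_) (Σ-const xs n)

Σ-*ˡ : ∀ (xs : List A) n g → Σ[ xs ] (λ x → n * g x) ≡ n * Σ[ xs ] g
Σ-*ˡ []       n g = sym (*-zeroʳ n)
Σ-*ˡ (x ∷ xs) n g = trans (cong (n * g x +_) (Σ-*ˡ xs n g)) (sym (*-distribˡ-+ n (g x) _))

Σ-+ : ∀ (xs : List A) f g → Σ[ xs ] (λ x → f x + g x) ≡ Σ[ xs ] f + Σ[ xs ] g
Σ-+ []       f g = refl
Σ-+ (x ∷ xs) f g rewrite Σ-+ xs f g = solve 4 (λ a b c d → (a :+ b) :+ (c :+ d) := (a :+ c) :+ (b :+ d)) refl (f x) (g x) _ _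
  where
  open +-*-Solver

Σ-swap : ∀ {B : Set} (xs : List A) (ys : List B) (f : A → B → ℕ) →
         Σ[ xs ] (λ x → Σ[ ys ] (f x)) ≡ Σ[ ys ] (λ y → Σ[ xs ] (λ x → f x y))
Σ-swap []       ys f = sym (trans (Σ-const ys 0) (*-zeroʳ (length ys)))
Σ-swap (x ∷ xs) ys f = trans (cong (Σ[ ys ] (f x) +_) (Σ-swap xs ys f)) (sym (Σ-+ ys (f x) _))

Σ-↭ : ∀ {xs ys : List A} g → xs ↭ ys → Σ[ xs ] g ≡ Σ[ ys ] g
Σ-↭ g p = sum-↭ (map⁺ g p)

-- Each term is at most X divided by the number of terms; the multiplied form avoids division. It
-- bounds the union of the red neighbourhoods that a new vertex of `G` must avoid.
Σ-length-scaled : ∀ (xs : List A) {g X} → (∀ {x} → x ∈ xs → length xs * g x ≤ X) → Σ[ xs ] g ≤ X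
Σ-length-scaled []          _     = z≤n
Σ-length-scaled xs@(_ ∷ _) {g} {X} bound = *-cancelˡ-≤ (length xs) (begin
  length xs * Σ[ xs ] g            ≡⟨ Σ-*ˡ xs (length xs) g ⟨
  Σ[ xs ] (λ x → length xs * g x)  ≤⟨ Σ-mono xs bound ⟩
  Σ[ xs ] (λ _ → X)                ≡⟨ Σ-const xs X ⟩
  length xs * X                    ∎)
  where
  open ≤-Reasoning

Σ-below-average : ∀ x (xs : List A) g → ∃ λ y → y ∈ x ∷ xs × length (x ∷ xs) * g y ≤ Σ[ x ∷ xs ] g
Σ-below-average x xs g with any? (λ y → length (x ∷ xs) * g y ≤? Σ[ x ∷ xs ] g) (x ∷ xs)
... | yes p = find p
... | no ¬p = ⊥-elim (<-irrefl refl (*-cancelˡ-≤ (length L) (begin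
  length L * suc (Σ[ L ] g)        ≡⟨ Σ-const L _ ⟨
  Σ[ L ] (λ _ → suc (Σ[ L ] g))    ≤⟨ Σ-mono L (λ y∈ → ≰⇒> (All.lookup (All.¬Any⇒All¬ L ¬p) y∈)) ⟩
  Σ[ L ] (λ y → length L * g y)    ≡⟨ Σ-*ˡ L (length L) g ⟩
  length L * Σ[ L ] g              ∎)))
  where
  open ≤-Reasoning
  L = x ∷ xs

markov : ∀ {P : Pred A 0ℓ} (P? : Decidable P) xs {g D} → (∀ {x} → P x → D ≤ g x) →
         length (filter P? xs) * D ≤ Σ[ xs ] g
markov P? []       _   = z≤n
markov P? (x ∷ xs) {g} D≤g with P? x
... | yes Px = +-mono-≤ (D≤g Px) (markov P? xs D≤g)
... | no  _  = ≤-trans (markov P? xs D≤g) (m≤n+m _ (g x))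

AllPairs-resp-⊆ : ∀ {R : Rel A 0ℓ} {xs ys} → xs ⊆ ys → AllPairs R ys → AllPairs R xs
AllPairs-resp-⊆ []         []        = []
AllPairs-resp-⊆ (_ ∷ʳ p)   (_ ∷ a)   = AllPairs-resp-⊆ p a
AllPairs-resp-⊆ (refl ∷ p) (h ∷ a)   = All-resp-⊆ p h ∷ AllPairs-resp-⊆ p a

Linked-take⁺ : ∀ {R : Rel A 0ℓ} n {xs} → Linked R xs → Linked R (take n xs)
Linked-take⁺ zero    _ = []
Linked-take⁺ (suc n) [] = []
Linked-take⁺ (suc n) [-] with n
... | zero = [-]
... | suc _ = [-]
Linked-take⁺ (suc zero) (r ∷ l) = [-]
Linked-take⁺ (suc (suc n)) (r ∷ l) = r ∷ Linked-take⁺ (suc n) l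

last⁺ : A → List A → A
last⁺ x []       = x
last⁺ x (y ∷ ys) = last⁺ y ys

last⁺∈ : ∀ (x : A) ys → last⁺ x ys ∈ x ∷ ys
last⁺∈ x []       = here refl
last⁺∈ x (y ∷ ys) = there (last⁺∈ y ys)

-- The Gallai-Roy theorem for the orientation given by a list

module GallaiRoy {A : Set} {_~_ : Rel A 0ℓ} (_~?_ : B.Decidable _~_) where

  NonAdj : Rel A 0ℓ
  NonAdj x y = ¬ (x ~ y)

  -- The elements without a later neighbour form an independent set; a path among the remaining
  -- elements can be prolonged beyond its end.
  record Peeling (xs : List A) : Set where
    field
      sinks rest  : List A
      sinks⊆      : sinks ⊆ xs
      rest⊆       : rest ⊆ xs
      independent : AllPairs NonAdj sinks
      lengths     : length xs ≡ length sinks + length rest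
      prolong     : ∀ {y ys} → (y ∷ ys) ⊆ rest → Linked _~_ (y ∷ ys) →
                    ∃ λ zs → (y ∷ zs) ⊆ xs × Linked _~_ (y ∷ zs) × length zs ≡ suc (length ys)

  peel : ∀ xs → Peeling xs
  peel [] = record
    { sinks = [] ; rest = [] ; sinks⊆ = [] ; rest⊆ = [] ; independent = [] ; lengths = refl ; prolong = λ () }
  peel (x ∷ xs) with any? (x ~?_) xs | peel xs
  ... | no ¬p | P = record
    { sinks = x ∷ sinks ; rest = rest ; sinks⊆ = refl ∷ sinks⊆ ; rest⊆ = x ∷ʳ rest⊆
    ; independent = All-resp-⊆ sinks⊆ (All.¬Any⇒All¬ xs ¬p) ∷ independent
    ; lengths = cong suc lengths
    ; prolong = λ p l → let zs , q , l′ , e = prolong p l in zs , x ∷ʳ q , l′ , e }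
    where
    open Peeling P
  ... | yes p | P = record
    { sinks = sinks ; rest = x ∷ rest ; sinks⊆ = x ∷ʳ sinks⊆ ; rest⊆ = refl ∷ rest⊆
    ; independent = independent
    ; lengths = trans (cong suc lengths) (sym (+-suc _ _))
    ; prolong = prolong′ }
    where
    open Peeling P
    prolong′ : ∀ {y ys} → (y ∷ ys) ⊆ (x ∷ rest) → Linked _~_ (y ∷ ys) →
               ∃ λ zs → (y ∷ zs) ⊆ (x ∷ xs) × Linked _~_ (y ∷ zs) × length zs ≡ suc (length ys)
    prolong′ (_ ∷ʳ q) l = let zs , q′ , l′ , e = prolong q l in zs , x ∷ʳ q′ , l′ , e
    prolong′ (refl ∷ q) [-] with z , z∈ , x~z ← find p =
      z ∷ [] , refl ∷ from∈ z∈ , x~z ∷ [-] , refl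
    prolong′ (refl ∷ q) (x~y ∷ l) = let zs , q′ , l′ , e = prolong q l in
      _ ∷ zs , refl ∷ q′ , x~y ∷ l′ , cong suc e

  -- After t peelings the list is split into t independent sets and a remainder. An element of the
  -- remainder grows by t prolongations into a path on t + 1 vertices; if the remainder is empty,
  -- the largest of the t sets has at least average size. The path is a sublist, hence follows the
  -- order of `xs`.
  path-or-independent : ∀ t xs →
    (∃₂ λ y ys → (y ∷ ys) ⊆ xs × Linked _~_ (y ∷ ys) × length ys ≡ t) ⊎
    (∃ λ is → is ⊆ xs × AllPairs NonAdj is × length xs ≤ t * length is)
  path-or-independent zero    []       = inj₂ ([] , [] , [] , z≤n)
  path-or-independent zero    (x ∷ xs) = inj₁ (x , [] , refl ∷ minimum xs , [-] , refl)
  path-or-independent (suc t) xs with path-or-independent t (Peeling.rest (peel xs))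
  ... | inj₁ (y , ys , p , l , e) =
    let zs , q , l′ , e′ = Peeling.prolong (peel xs) p l in
    inj₁ (y , zs , q , l′ , trans e′ (cong suc e))
  ... | inj₂ (is , p , ind , le) with ≤-total (length (Peeling.sinks (peel xs))) (length is)
  ...   | inj₁ s≤i = inj₂ (is , ⊆-trans p rest⊆ , ind , (begin
    length xs                      ≡⟨ lengths ⟩
    length sinks + length rest     ≤⟨ +-mono-≤ s≤i le ⟩
    length is + t * length is      ∎))
    where
    open Peeling (peel xs)
    open ≤-Reasoning
  ...   | inj₂ i≤s = inj₂ (sinks , sinks⊆ , independent , (begin
    length xs                        ≡⟨ lengths ⟩
    length sinks + length rest       ≤⟨ +-monoʳ-≤ (length sinks) (≤-trans le (*-monoʳ-≤ t i≤s)) ⟩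
    length sinks + t * length sinks  ∎))
    where
    open Peeling (peel xs)
    open ≤-Reasoning

-- Positions and windows in lists

Linked-drop⁺ : ∀ {R : Rel A 0ℓ} n {xs} → Linked R xs → Linked R (drop n xs)
Linked-drop⁺ zero    l       = l
Linked-drop⁺ (suc n) []      = []
Linked-drop⁺ (suc n) [-]     = Linked-drop⁺ n []
Linked-drop⁺ (suc n) (_ ∷ l) = Linked-drop⁺ n l

Unique-lookup-injective : ∀ {xs : List A} → Unique xs → ∀ {i j} → lookup xs i ≡ lookup xs j → i ≡ j
Unique-lookup-injective (_ ∷ _)  {zero}  {zero}  _ = refl
Unique-lookup-injective (x∉ ∷ _) {zero}  {suc j} e = ⊥-elim (All.lookup x∉ (∈-lookup j) e)
Unique-lookup-injective (x∉ ∷ _) {suc i} {zero}  e = ⊥-elim (All.lookup x∉ (∈-lookup i) (sym e))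
Unique-lookup-injective (_ ∷ u)  {suc i} {suc j} e = cong suc (Unique-lookup-injective u e)

Linked-lookup : ∀ {R : Rel A 0ℓ} {xs} → Linked R xs → ∀ i j → toℕ j ≡ suc (toℕ i) → R (lookup xs i) (lookup xs j)
Linked-lookup [-]     zero    zero          ()
Linked-lookup (r ∷ l) zero    (suc zero)    _ = r
Linked-lookup (r ∷ l) (suc i) (suc j)       e = Linked-lookup l i j (suc-injective e)

lookup-last⁺ : ∀ (x : A) xs i → length xs ≡ toℕ i → lookup (x ∷ xs) i ≡ last⁺ x xs
lookup-last⁺ x []       zero    _ = refl
lookup-last⁺ x (y ∷ ys) (suc i) e = lookup-last⁺ y ys i (suc-injective e)

AllPairs-lookup : ∀ {R : Rel A 0ℓ} → Symmetric R → (∀ {x} → R x x) → ∀ {xs x y} → AllPairs R xs →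
                  x ∈ xs → y ∈ xs → R x y
AllPairs-lookup s r (h ∷ a) (here refl) (here refl) = r
AllPairs-lookup s r (h ∷ a) (here refl) (there y∈)  = All.lookup h y∈
AllPairs-lookup s r (h ∷ a) (there x∈)  (here refl) = s (All.lookup h x∈)
AllPairs-lookup s r (h ∷ a) (there x∈)  (there y∈)  = AllPairs-lookup s r a x∈ y∈

-- The bound on the index `i` of the change guarantees that a long list continues far enough beyond
-- it for a window to be cut out there.
first-change : ∀ {A B : Set} → DecidableEquality B → (f : A → B) → ∀ n y ys → n ≤ length ys →
  All (λ z → f z ≡ f y) (take n ys) ⊎
  (∃ λ i → ∃₂ λ a b → ∃ λ zs → drop i (y ∷ ys) ≡ a ∷ b ∷ zs × f a ≢ f b × i < n)
first-change _≟_ f zero    y ys        _ = inj₁ []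
first-change _≟_ f (suc n) y (z ∷ zs) (s≤s n≤) with f z ≟ f y
... | no  z≢y = inj₂ (0 , y , z , zs , refl , z≢y ∘ sym , s≤s z≤n)
... | yes z≡y with first-change _≟_ f n z zs n≤
...   | inj₁ all = inj₁ (z≡y ∷ All.map (λ e → trans e z≡y) all)
...   | inj₂ (i , a , b , ys , e , a≢b , i<n) = inj₂ (suc i , a , b , ys , e , a≢b , s≤s i<n)

-- Red cycles through the first two spheres around a vertex

-- From here on j = 2k - 4, so that the cycle in question has j + 5 vertices.
module Red {N : ℕ} (c : Colouring N) (c-sym : SymmetricColouring c) (j : ℕ) where

  _~_ : Rel (Fin N) 0ℓ
  x ~ y = x ≢ y × c x y ≡ red

  _~?_ : B.Decidable _~_
  x ~? y = ¬? (x Fin.≟ y) ×-dec (c x y Bool.≟ red)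

  ~-sym : Symmetric _~_
  ~-sym (x≢y , xy) = x≢y ∘ sym , trans (c-sym _ _) xy

  ~-irrefl : ∀ {x} → ¬ (x ~ x)
  ~-irrefl (x≢x , _) = x≢x refl

  open GallaiRoy _~?_ public

  Cycle : Set
  Cycle = HasCycleCopy c red (4 + j)

  close : ∀ z zs → Unique (z ∷ zs) → Linked _~_ (z ∷ zs) → last⁺ z zs ~ z → length zs ≡ 4 + j → Cycle
  close z zs u l cl refl′ = subst (HasCycleCopy c red) refl′
    (lookup (z ∷ zs) , Unique-lookup-injective u , edge)
    where
    edge : ∀ i → c (lookup (z ∷ zs) i) (lookup (z ∷ zs) (next i)) ≡ red
    edge i with length zs ≟ toℕ i
    -- `next` wraps around exactly at the last index, where the closing edge is needed.
    ... | yes e = subst (λ x → c x z ≡ red) (sym (lookup-last⁺ z zs i e)) (proj₂ cl)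
    ... | no ne = proj₂ (Linked-lookup l i _ (Fin.toℕ-lower₁ (suc i) (ne ∘ suc-injective)))

  -- The first 4 + j vertices of the path form a cycle with `v`, which is adjacent to both of their
  -- ends.
  fan-cycle : ∀ v ys → All (v ~_) ys → Unique ys → Linked _~_ ys → 4 + j ≤ length ys → Cycle
  fan-cycle v ys@(y ∷ ys′) vs u l len =
    close v (take (4 + j) ys)
      (All.map proj₁ vs′ ∷ AllPairs.take⁺ (4 + j) u)
      (All.head vs ∷ Linked-take⁺ (4 + j) l)
      (~-sym (All.lookup vs′ (last⁺∈ y (take (3 + j) ys′))))
      (trans (length-take (4 + j) ys) (m≤n⇒m⊓n≡m len))
    where vs′ = All.take⁺ (4 + j) vs

  -- The cycle runs through `w′`, `v`, `w` and then along `xs` back to `w′`: 3 + (2 + j) vertices.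
  -- Those of `xs` are not adjacent to `v`, and therefore differ from `w` and `w′`.
  two-branch-cycle : ∀ v w w′ xs → v ~ w → v ~ w′ → w ≢ w′ →
    All (λ x → x ≢ v × ¬ (v ~ x)) xs → Unique xs → Linked _~_ (w ∷ xs) → last⁺ w xs ~ w′ →
    length xs ≡ 2 + j → Cycle
  two-branch-cycle v w w′ xs vw vw′ w≢w′ far u l cl e =
    close w′ (v ∷ w ∷ xs)
      ((proj₁ (~-sym vw′) ∷ w≢w′ ∘ sym ∷ off vw′) ∷
       (proj₁ vw ∷ All.map (λ f → proj₁ f ∘ sym) far) ∷ off vw ∷ u)
      (~-sym vw′ ∷ vw ∷ l) cl (cong (2 +_) e)
    where
    off : ∀ {z} → v ~ z → All (z ≢_) xs
    off vz = All.map (λ f z≡x → proj₂ f (subst (v ~_) z≡x vz)) far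

  record IndependentIn (xs : List (Fin N)) : Set where
    constructor mkInd
    field
      elems  : List (Fin N)
      sub    : ∀ {x} → x ∈ elems → x ∈ xs
      unique : Unique elems
      indep  : ∀ {x y} → x ∈ elems → y ∈ elems → ¬ (x ~ y)
  open IndependentIn public

  size : ∀ {xs} → IndependentIn xs → ℕ
  size I = length (elems I)

  path-or-independent′ : ∀ t xs → Unique xs →
    (∃₂ λ y ys → (y ∷ ys) ⊆ xs × Linked _~_ (y ∷ ys) × length ys ≡ t) ⊎
    (∃ λ (I : IndependentIn xs) → length xs ≤ t * size I)
  path-or-independent′ t xs u with path-or-independent t xs
  ... | inj₁ p = inj₁ p
  ... | inj₂ (is , p , ind , le) = inj₂ (mkInd is (Any-resp-⊆ p) (AllPairs-resp-⊆ p u)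
        (AllPairs-lookup (λ ¬xy → ¬xy ∘ ~-sym) ~-irrefl ind) , le)

  -- Twice the number of path vertices that a fan needs: a path with `T` edges has room for a change
  -- of parent near its start and a whole window after it. The same number bounds the average red
  -- degree inside a neighbourhood.
  T : ℕ
  T = 2 * (4 + j)

  neighbours-independent : ∀ v ws → All (v ~_) ws → Unique ws →
    Cycle ⊎ ∃ λ (I : IndependentIn ws) → length ws ≤ T * size I
  neighbours-independent v ws vw u with path-or-independent′ T ws u
  ... | inj₂ I = inj₂ I
  ... | inj₁ (y , ys , p , l , e) = inj₁ (fan-cycle v (y ∷ ys) (All-resp-⊆ p vw) (AllPairs-resp-⊆ p u) l
          (≤-trans (m≤m+n (4 + j) _) (m≤n⇒m≤1+n (≤-reflexive (sym e)))))

  -- Sorting by parent makes the members of each branch consecutive, so a long path that is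
  -- monotone in this order either stays in one branch or has a window with ends in two branches.
  module SecondNeighbours (v : Fin N) (ws xs : List (Fin N)) (vw : All (v ~_) ws) (u : Unique xs)
    (far : All (λ x → x ≢ v × ¬ (v ~ x) × Any (_~ x) ws) xs) where

    pick : ∀ x → Σ (Fin N) λ w → Any (_~ x) ws → w ∈ ws × w ~ x
    pick x with any? (_~? x) ws
    ... | yes p = let w , w∈ , w~x = find p in w , λ _ → w∈ , w~x
    -- `v` is an arbitrary default, which makes `parent` a total function to sort by.
    ... | no ¬p = v , ⊥-elim ∘ ¬p

    parent : Fin N → Fin N
    parent = proj₁ ∘ pick

    order : DecTotalOrder 0ℓ 0ℓ 0ℓ
    order = On.decTotalOrder (Fin.≤-decTotalOrder N) parent

    open Data.List.Sort order using (sort; sort-↭; sort-↗)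

    u-sort : Unique (sort xs)
    u-sort = Unique-resp-↭ (setoid _) (↭⇒↭ₛ (↭-sym (sort-↭ xs))) u

    Monotone : List (Fin N) → Set
    Monotone = AllPairs (λ x y → toℕ (parent x) ≤ toℕ (parent y))

    Below : Fin N → Set
    Below x = x ≢ v × ¬ (v ~ x) × v ~ parent x × parent x ~ x

    below : All Below (sort xs)
    below = All.tabulate λ {x} x∈ →
      let x≢v , v≁x , p = All.lookup far (∈-resp-↭ (sort-↭ xs) x∈) ; w∈ , w~x = proj₂ (pick x) p
      in x≢v , v≁x , All.lookup vw w∈ , w~x

    window-cycle : ∀ a b zs → parent a ≢ parent b → j ≤ length zs →
      All Below (a ∷ b ∷ zs) → Unique (a ∷ b ∷ zs) → Linked _~_ (a ∷ b ∷ zs) → Monotone (a ∷ b ∷ zs) → Cycle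
    window-cycle a b zs a≢b len bel u l mono =
      two-branch-cycle v (parent a) (parent z) (take (2 + j) (a ∷ b ∷ zs))
        (proj₁ (proj₂ (proj₂ (All.head bel)))) (proj₁ (proj₂ (proj₂ bz)))
        a≢z (All.map (λ (p , q , _) → p , q) bel′) (AllPairs.take⁺ (2 + j) u)
        (proj₂ (proj₂ (proj₂ (All.head bel))) ∷ Linked-take⁺ (2 + j) l)
        (~-sym (proj₂ (proj₂ (proj₂ bz))))
        (cong (2 +_) (trans (length-take j zs) (m≤n⇒m⊓n≡m len)))
      where
      z = last⁺ b (take j zs)
      z∈ : z ∈ b ∷ take j zs
      z∈ = last⁺∈ b (take j zs)
      bel′ = All.take⁺ (2 + j) bel
      bz : Below z
      bz = All.lookup (All.tail bel′) z∈
      b≤z : toℕ (parent b) ≤ toℕ (parent z)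
      b≤z with z∈ | AllPairs.take⁺ (2 + j) mono
      ... | here e    | _           = ≤-reflexive (cong (toℕ ∘ parent) (sym e))
      ... | there z∈′ | _ ∷ h ∷ _   = All.lookup h z∈′
      a≢z : parent a ≢ parent z
      -- Parents do not decrease along the window, so equal parents at its ends would force the
      -- parent of `b` to be the same.
      a≢z e = a≢b (Fin.toℕ-injective (≤-antisym (All.head (AllPairs.head mono))
        (≤-trans b≤z (≤-reflexive (cong toℕ (sym e))))))

    long-path-cycle : ∀ y ys → length ys ≡ T →
      All Below (y ∷ ys) → Unique (y ∷ ys) → Linked _~_ (y ∷ ys) → Monotone (y ∷ ys) → Cycle
    long-path-cycle y ys e bel u l mono
      with first-change Fin._≟_ parent (3 + j) y ys (≤-trans (n≤1+n (3 + j)) (≤-trans (m≤m+n (4 + j) _) (≤-reflexive (sym e))))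
    -- Here 4 + j consecutive vertices share one parent, the centre of a fan.
    ... | inj₁ same = fan-cycle (parent y) (take (4 + j) (y ∷ ys))
      (proj₂ (proj₂ (proj₂ (All.head bel))) ∷
        All.zipWith (λ (s , _ , _ , _ , q) → subst (_~ _) s q) (same , All.take⁺ (3 + j) (All.tail bel)))
      (AllPairs.take⁺ (4 + j) u) (Linked-take⁺ (4 + j) l)
      (≤-reflexive (sym (trans (length-take (4 + j) (y ∷ ys))
        (m≤n⇒m⊓n≡m (≤-trans (m≤m+n (4 + j) _) (m≤n⇒m≤1+n (≤-reflexive (sym e))))))))
    ... | inj₂ (i , a , b , zs , eq , a≢b , i<) =
      window-cycle a b zs a≢b len
        (subst (All Below) eq (All.drop⁺ i bel)) (subst Unique eq (AllPairs.drop⁺ i u))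
        (subst (Linked _~_) eq (Linked-drop⁺ i l)) (subst Monotone eq (AllPairs.drop⁺ i mono))
      where
      open ≤-Reasoning
      len : j ≤ length zs
      len = +-cancelˡ-≤ (2 + i) _ _ (begin
        2 + i + j                           ≤⟨ +-monoˡ-≤ j (+-monoʳ-≤ 2 (s≤s⁻¹ i<)) ⟩
        4 + j + j                           ≤⟨ +-monoʳ-≤ (4 + j) (m≤n+m j 4) ⟩
        4 + j + (4 + j)                     ≡⟨ cong (4 + j +_) (+-identityʳ (4 + j)) ⟨
        T                                   ≤⟨ n≤1+n T ⟩
        suc T                               ≡⟨ cong suc e ⟨
        length (y ∷ ys)                     ≤⟨ m≤n+m∸n (length (y ∷ ys)) i ⟩
        i + (length (y ∷ ys) ∸ i)           ≡⟨ cong (i +_) (length-drop i (y ∷ ys)) ⟨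
        i + length (drop i (y ∷ ys))        ≡⟨ cong (λ us → i + length us) eq ⟩
        i + (2 + length zs)                 ≡⟨ +-assoc i 2 _ ⟨
        i + 2 + length zs                   ≡⟨ cong (_+ length zs) (+-comm i 2) ⟩
        2 + i + length zs                   ∎)

    independent : Cycle ⊎ ∃ λ (I : IndependentIn xs) → length xs ≤ T * size I
    independent with path-or-independent′ T (sort xs) u-sort
    ... | inj₂ (mkInd is sub un ind , le) =
      inj₂ (mkInd is (∈-resp-↭ (sort-↭ xs) ∘ sub) un ind , subst (_≤ T * length is) (↭-length (sort-↭ xs)) le)
    ... | inj₁ (y , ys , p , l , e) = inj₁ (long-path-cycle y ys e
      (All-resp-⊆ p below) (AllPairs-resp-⊆ p u-sort) l
      (AllPairs-resp-⊆ p (Linked⇒AllPairs ≤-trans (sort-↗ xs))))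

  -- Large red-independent sets: the Ramsey number of a cycle and a clique

  join : ∀ {xs ys zs} (I : IndependentIn xs) (J : IndependentIn ys) →
    (∀ {x y} → x ∈ xs → y ∈ ys → x ≢ y × ¬ (x ~ y)) →
    (∀ {x} → x ∈ xs → x ∈ zs) → (∀ {x} → x ∈ ys → x ∈ zs) →
    ∃ λ (K : IndependentIn zs) → size K ≡ size I + size J
  join {zs = zs} I J apart xs⊆ ys⊆ =
    mkInd (elems I ++ elems J) sub′
      (Unique.++⁺ (unique I) (unique J) λ (x∈I , x∈J) → proj₁ (apart (sub I x∈I) (sub J x∈J)) refl)
      indep′ , length-++ (elems I)
    where
    sub′ : ∀ {x} → x ∈ elems I ++ elems J → x ∈ zs
    sub′ x∈ with ∈-++⁻ (elems I) x∈
    ... | inj₁ x∈I = xs⊆ (sub I x∈I)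
    ... | inj₂ x∈J = ys⊆ (sub J x∈J)
    indep′ : ∀ {x y} → x ∈ elems I ++ elems J → y ∈ elems I ++ elems J → ¬ (x ~ y)
    indep′ x∈ y∈ with ∈-++⁻ (elems I) x∈ | ∈-++⁻ (elems I) y∈
    ... | inj₁ x∈I | inj₁ y∈I = indep I x∈I y∈I
    ... | inj₁ x∈I | inj₂ y∈J = proj₂ (apart (sub I x∈I) (sub J y∈J))
    ... | inj₂ x∈J | inj₁ y∈I = proj₂ (apart (sub I y∈I) (sub J x∈J)) ∘ ~-sym
    ... | inj₂ x∈J | inj₂ y∈J = indep J x∈J y∈J

  singleton : ∀ v → IndependentIn (v ∷ [])
  singleton v = mkInd (v ∷ []) (λ x∈ → x∈) ([] ∷ []) λ { (here refl) (here refl) → ~-irrefl }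

  -- Either v alone or an independent part of its neighbourhood is chosen. In the second case the
  -- second sphere is small relative to the first, unless it contains n independent vertices.
  independent-or-cycle : ∀ n h → n ≤ h * h → ∀ f xs → length xs ≤ f → Unique xs →
    Cycle ⊎ ∃ λ (I : IndependentIn xs) → n ≤ size I ⊎ length xs ≤ T * (T * h + 2) * size I
  independent-or-cycle n h _ f [] _ _ = inj₂ (mkInd [] (λ ()) [] (λ ()) , inj₂ z≤n)
  independent-or-cycle n h n≤ (suc f) (v ∷ xs) (s≤s len) (v∉ ∷ u)
    with length (filter (v ~?_) xs) ≤? h
  -- Few neighbours: `v` is chosen and its at most h neighbours are given up, which 1 + h ≤ M pays
  -- for.
  ... | yes small with independent-or-cycle n h n≤ f (filter (¬? ∘ (v ~?_)) xs)
                        (≤-trans (length-filter _ xs) len) (Unique.filter⁺ _ u)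
  ...   | inj₁ cyc = inj₁ cyc
  ...   | inj₂ (J , bound) with join {zs = v ∷ xs} (singleton v) J
            (λ { (here refl) y∈ → let y∈′ , v≁y = ∈-filter⁻ _ y∈ in All.lookup v∉ y∈′ , v≁y })
            (λ { (here refl) → here refl })
            (λ y∈ → there (proj₁ (∈-filter⁻ _ y∈)))
  ...     | K , |K| with bound
  ...       | inj₁ n≤J = inj₂ (K , inj₁ (≤-trans n≤J (≤-trans (n≤1+n _) (≤-reflexive (sym |K|)))))
  ...       | inj₂ le = inj₂ (K , inj₂ (begin
    suc (length xs)                             ≡⟨ cong suc (length-filter-split (v ~?_) xs) ⟩
    suc (length N₁ + length out)                ≤⟨ +-mono-≤ (s≤s small) le ⟩
    suc h + M * size J                          ≤⟨ +-monoˡ-≤ (M * size J) 1+h≤M ⟩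
    M + M * size J                              ≡⟨ *-suc M (size J) ⟨
    M * suc (size J)                            ≡⟨ cong (M *_) |K| ⟨
    M * size K                                  ∎))
    where
    open ≤-Reasoning
    M = T * (T * h + 2)
    N₁ = filter (v ~?_) xs
    out = filter (¬? ∘ (v ~?_)) xs
    1+h≤M : suc h ≤ M
    1+h≤M = begin
      suc h          ≡⟨ +-comm 1 h ⟩
      h + 1          ≤⟨ +-mono-≤ (m≤n*m h T) (n≤1+n 1) ⟩
      T * h + 2      ≤⟨ m≤n*m (T * h + 2) T ⟩
      M              ∎
  -- Many neighbours: `v` and both spheres are given up for an independent part of the first sphere,
  -- to which nothing in `rest` is adjacent.
  independent-or-cycle n h n≤ (suc f) (v ∷ xs) (s≤s len) (v∉ ∷ u) | no large =
    combine (neighbours-independent v N₁ v~N₁ (Unique.filter⁺ _ u))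
            (SecondNeighbours.independent v N₁ N₂ v~N₁ (Unique.filter⁺ _ (Unique.filter⁺ _ u)) far)
            (independent-or-cycle n h n≤ f rest (≤-trans (length-filter _ out) (≤-trans (length-filter _ xs) len))
              (Unique.filter⁺ _ (Unique.filter⁺ _ u)))
    where
    M = T * (T * h + 2)
    N₁ = filter (v ~?_) xs
    out = filter (¬? ∘ (v ~?_)) xs
    near? : Decidable (λ x → Any (_~ x) N₁)
    near? x = any? (_~? x) N₁
    N₂ = filter near? out
    rest = filter (¬? ∘ near?) out
    out⊆ : ∀ {x} → x ∈ out → x ∈ xs × ¬ (v ~ x)
    out⊆ = ∈-filter⁻ _
    v~N₁ : All (v ~_) N₁
    v~N₁ = All.all-filter (v ~?_) xs
    far : All (λ x → x ≢ v × ¬ (v ~ x) × Any (_~ x) N₁) N₂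
    far = All.tabulate λ x∈ → let x∈out , near = ∈-filter⁻ near? x∈ ; x∈xs , v≁x = out⊆ x∈out in
      All.lookup v∉ x∈xs ∘ sym , v≁x , near
    combine : Cycle ⊎ (∃ λ (I : IndependentIn N₁) → length N₁ ≤ T * size I) →
              Cycle ⊎ (∃ λ (I : IndependentIn N₂) → length N₂ ≤ T * size I) →
              Cycle ⊎ (∃ λ (I : IndependentIn rest) → n ≤ size I ⊎ length rest ≤ M * size I) →
              Cycle ⊎ ∃ λ (I : IndependentIn (v ∷ xs)) → n ≤ size I ⊎ suc (length xs) ≤ M * size I
    combine (inj₁ cyc) _ _ = inj₁ cyc
    combine (inj₂ _) (inj₁ cyc) _ = inj₁ cyc
    combine (inj₂ _) (inj₂ _) (inj₁ cyc) = inj₁ cyc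
    combine (inj₂ (I₁ , le₁)) (inj₂ (I₂ , le₂)) (inj₂ (J , bound)) with n ≤? size I₂
    ... | yes n≤I₂ = inj₂ (mkInd (elems I₂) (λ x∈ → there (proj₁ (out⊆ (proj₁ (∈-filter⁻ near? (sub I₂ x∈))))))
                             (unique I₂) (indep I₂) , inj₁ n≤I₂)
    ... | no n≰I₂ with join {zs = v ∷ xs} I₁ J apart (λ x∈ → there (proj₁ (∈-filter⁻ (v ~?_) x∈)))
                         (λ y∈ → there (proj₁ (out⊆ (proj₁ (∈-filter⁻ _ y∈)))))
      where
      apart : ∀ {x y} → x ∈ N₁ → y ∈ rest → x ≢ y × ¬ (x ~ y)
      apart {x} x∈ y∈ = let y∈out , ¬near = ∈-filter⁻ _ y∈ in
        (λ { refl → proj₂ (out⊆ y∈out) (All.lookup v~N₁ x∈) }) , λ x~y → ¬near (lose x∈ x~y)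
    ...   | K , |K| with bound
    ...     | inj₁ n≤J = inj₂ (K , inj₁ (≤-trans n≤J (≤-trans (m≤n+m _ (size I₁)) (≤-reflexive (sym |K|)))))
    ...     | inj₂ le = inj₂ (K , inj₂ (begin
      suc (length xs)                                          ≡⟨ cong suc (length-filter-split (v ~?_) xs) ⟩
      suc (a + length out)                                     ≡⟨ cong (λ l → suc (a + l)) (length-filter-split near? out) ⟩
      suc (a + (length N₂ + length rest))                      ≤⟨ s≤s (+-monoʳ-≤ a (+-mono-≤ N₂≤ le)) ⟩
      -- The vertex `v` is charged to a second copy of `a`, whence the 2 in `M`.
      suc (a + (T * (h * a) + M * size J))                     ≤⟨ +-monoˡ-≤ _ (≤-trans (s≤s z≤n) (≰⇒> large)) ⟩
      a + (a + (T * (h * a) + M * size J))                     ≡⟨ solve 4 (λ a t h m →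
        a :+ (a :+ (t :* (h :* a) :+ m)) := (t :* h :+ con 2) :* a :+ m) refl a T h (M * size J) ⟩
      (T * h + 2) * a + M * size J                             ≤⟨ +-monoˡ-≤ _ (*-monoʳ-≤ (T * h + 2) le₁) ⟩
      (T * h + 2) * (T * size I₁) + M * size J                 ≡⟨ solve 4 (λ b t i j →
        b :* (t :* i) :+ t :* b :* j := t :* b :* (i :+ j)) refl (T * h + 2) T (size I₁) (size J) ⟩
      M * (size I₁ + size J)                                   ≡⟨ cong (M *_) |K| ⟨
      M * size K                                               ∎))
      where
      open ≤-Reasoning
      open +-*-Solver
      a = length N₁
      -- Having fewer than n independent vertices, the second sphere has at most T n ≤ T h h
      -- vertices, and h < a in this case.
      N₂≤ : length N₂ ≤ T * (h * a)
      N₂≤ = ≤-trans le₂ (*-monoʳ-≤ T (≤-trans (<⇒≤ (≰⇒> n≰I₂)) (≤-trans n≤ (*-monoʳ-≤ h (<⇒≤ (≰⇒> large))))))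

-- Degrees and degree sums

length-concatMap : ∀ {B : Set} (f : A → List B) xs → length (concatMap f xs) ≡ Σ[ xs ] (length ∘ f)
length-concatMap f []       = refl
length-concatMap f (x ∷ xs) = trans (length-++ (f x)) (cong (length (f x) +_) (length-concatMap f xs))

Unique-↭ : ∀ {xs ys : List A} → xs ↭ ys → Unique xs → Unique ys
Unique-↭ p = Unique-resp-↭ (setoid _) (↭⇒↭ₛ p)

-- The relation is arbitrary because both the red graph and `G` are instances.
module Degrees {A : Set} {_~_ : Rel A 0ℓ} (_~?_ : B.Decidable _~_)
               (~-sym : Symmetric _~_) (~-irrefl : ∀ {x} → ¬ (x ~ x)) where

  degree : List A → A → ℕ
  degree xs x = length (filter (x ~?_) xs)

  degreeSum : List A → ℕ
  degreeSum xs = Σ[ xs ] (degree xs)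

  degreeSum-↭ : ∀ {xs ys} → xs ↭ ys → degreeSum xs ≡ degreeSum ys
  degreeSum-↭ {xs} {ys} p = ≤-antisym
    (≤-trans (Σ-mono xs λ {x} _ → ≤-reflexive (↭-length (filter-↭ (x ~?_) p))) (≤-reflexive (Σ-↭ (degree ys) p)))
    (≤-trans (Σ-mono ys λ {x} _ → ≤-reflexive (sym (↭-length (filter-↭ (x ~?_) p))))
      (≤-reflexive (sym (Σ-↭ (degree xs) p))))

  -- The element `x` adds one to the degree of each of its neighbours in `ys`; by symmetry these
  -- number `degree ys x`.
  Σ-degree-∷ : ∀ x xs ys → Σ[ ys ] (degree (x ∷ xs)) ≡ degree ys x + Σ[ ys ] (degree xs)
  Σ-degree-∷ x xs [] = refl
  Σ-degree-∷ x xs (y ∷ ys) with y ~? x | x ~? y | Σ-degree-∷ x xs ys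
  ... | yes _   | yes _   | e = cong suc (trans (cong (degree xs y +_) e)
    (trans (sym (+-assoc (degree xs y) _ _)) (trans (cong (_+ Σ[ ys ] (degree xs)) (+-comm (degree xs y) _)) (+-assoc (degree ys x) _ _))))
  ... | no _    | no _    | e = trans (cong (degree xs y +_) e)
    (trans (sym (+-assoc (degree xs y) _ _)) (trans (cong (_+ Σ[ ys ] (degree xs)) (+-comm (degree xs y) _)) (+-assoc (degree ys x) _ _)))
  ... | yes y~x | no ¬x~y | _ = ⊥-elim (¬x~y (~-sym y~x))
  ... | no ¬y~x | yes x~y | _ = ⊥-elim (¬y~x (~-sym x~y))

  degreeSum-∷ : ∀ x xs → degreeSum (x ∷ xs) ≡ degree xs x + (degree xs x + degreeSum xs)
  degreeSum-∷ x xs = cong₂ _+_ (cong length (filter-reject (x ~?_) {x} {xs} ~-irrefl)) (Σ-degree-∷ x xs xs)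

  -- A vertex of at most average degree serves in place of one of minimum degree: it gives n δ ≤ 2m
  -- without division. The degree sum does not grow on removal, so the bound stays available down
  -- the induction.
  remove-below-average : ∀ x xs → ∃₂ λ y ys → x ∷ xs ↭ y ∷ ys ×
    suc (length ys) * degree ys y ≤ degreeSum (x ∷ xs) × degreeSum ys ≤ degreeSum (x ∷ xs)
  remove-below-average x xs with y , y∈ , le ← Σ-below-average x xs (degree (x ∷ xs))
                            with ys , p ← extract y∈ =
    y , ys , p ,
    ≤-trans (≤-reflexive (cong₂ _*_ (sym (↭-length p))
      (sym (trans (↭-length (filter-↭ (y ~?_) p)) (cong length (filter-reject (y ~?_) {y} {ys} ~-irrefl)))))) le ,
    ≤-trans (≤-trans (m≤n+m _ (degree ys y)) (m≤n+m _ (degree ys y)))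
      (≤-reflexive (sym (trans (degreeSum-↭ p) (degreeSum-∷ y ys))))

-- Sparsity of red neighbourhoods

module Sparse {N : ℕ} (c : Colouring N) (c-sym : SymmetricColouring c) (j : ℕ) where
  open Red c c-sym j
  open Degrees _~?_ ~-sym ~-irrefl

  -- While the path has fewer than 4 + j vertices, its first vertex has a neighbour off it, which is
  -- put in front.
  greedy-path : ∀ {xs v} → v ∈ xs → (∀ {x} → x ∈ xs → 4 + j ≤ degree xs x) → Unique xs → ∀ n → n < 4 + j →
    ∃₂ λ y ys → All (_∈ xs) (y ∷ ys) × Unique (y ∷ ys) × Linked _~_ (y ∷ ys) × length ys ≡ n
  greedy-path {v = v} v∈ rich u zero _ = v , [] , v∈ ∷ [] , [] ∷ [] , [-] , refl
  greedy-path v∈ rich u (suc n) n<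
    with y , ys , y∈ ∷ ys∈ , uy , l , refl ← greedy-path v∈ rich u n (<⇒≤ n<)
    with z , z∈ , z∉ ← fresh Fin._≟_ {ys = y ∷ ys} (Unique.filter⁺ (y ~?_) u) (≤-trans n< (rich y∈))
    = let z∈xs , y~z = ∈-filter⁻ (y ~?_) z∈ in
      z , y ∷ ys , z∈xs ∷ y∈ ∷ ys∈ , All.tabulate (λ w∈ z≡w → z∉ (subst (_∈ y ∷ ys) (sym z≡w) w∈)) ∷ uy ,
      ~-sym y~z ∷ l , refl

  -- If every degree within `xs` were at least 4 + j, a greedy path would complete a fan around `v`.
  -- Otherwise a vertex of smaller degree is removed, which lowers the degree sum by at most `T`.
  -- The bound `f` on the length makes the recursion structural.
  neighbourhood-sparse : ∀ v f xs → length xs ≤ f → Unique xs → All (v ~_) xs →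
    Cycle ⊎ degreeSum xs ≤ T * length xs
  neighbourhood-sparse v f [] _ _ _ = inj₂ z≤n
  neighbourhood-sparse v (suc f) xs@(x₀ ∷ xs₀) (s≤s len) u vxs with any? (λ x → degree xs x <? 4 + j) xs
  ... | no ¬p with y , ys , ys∈ , uy , l , e ← greedy-path {xs} (here refl)
                   (λ x∈ → ≮⇒≥ (All.lookup (All.¬Any⇒All¬ xs ¬p) x∈)) u (3 + j) ≤-refl
              = inj₁ (fan-cycle v (y ∷ ys) (All.map (All.lookup vxs) ys∈) uy l (≤-reflexive (cong suc (sym e))))
  ... | yes p with x , x∈ , low ← find p with ys , π ← extract x∈
              with u′ ← Unique-↭ π u | vys ← All-resp-↭ π vxs
              with neighbourhood-sparse v f ys
                     (≤-trans (≤-reflexive (sym (suc-injective (↭-length π)))) len) (AllPairs.tail u′) (All.tail vys)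
  ...   | inj₁ cyc = inj₁ cyc
  ...   | inj₂ le = inj₂ (begin
    degreeSum xs                                    ≡⟨ trans (degreeSum-↭ π) (degreeSum-∷ x ys) ⟩
    degree ys x + (degree ys x + degreeSum ys)      ≤⟨ +-mono-≤ low′ (+-mono-≤ low′ le) ⟩
    4 + j + (4 + j + T * length ys)                 ≡⟨ +-assoc (4 + j) (4 + j) _ ⟨
    4 + j + (4 + j) + T * length ys                 ≡⟨ cong (λ t → 4 + j + t + T * length ys) (+-identityʳ (4 + j)) ⟨
    T + T * length ys                               ≡⟨ *-suc T (length ys) ⟨
    T * suc (length ys)                             ≡⟨ cong (T *_) (↭-length π) ⟨
    T * length xs                                   ∎)
    where
    open ≤-Reasoning
    low′ : degree ys x ≤ 4 + j
    low′ = begin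
      degree ys x          ≡⟨ cong length (filter-reject (x ~?_) {x} {ys} ~-irrefl) ⟨
      degree (x ∷ ys) x    ≡⟨ ↭-length (filter-↭ (x ~?_) π) ⟨
      degree xs x          ≤⟨ <⇒≤ low ⟩
      4 + j                ∎

-- Greedy embeddings into blue

module Embedding {N p : ℕ} (c : Colouring N) (c-sym : SymmetricColouring c) (j : ℕ) (G : SimpleGraph p) where
  open Red c c-sym j
  open Sparse c c-sym j

  _⌢_ : Rel (Fin p) 0ℓ
  x ⌢ y = Adj G x y ≡ true

  _⌢?_ : B.Decidable _⌢_
  x ⌢? y = Adj G x y Bool.≟ true

  ⌢-sym : Symmetric _⌢_
  ⌢-sym = trans (SimpleGraph.sym G _ _)

  ⌢-irrefl : ∀ {x} → ¬ (x ⌢ x)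
  ⌢-irrefl {x} xx with () ← trans (sym xx) (irrefl G x)

  module R = Degrees _~?_ ~-sym ~-irrefl
  module H = Degrees _⌢?_ ⌢-sym ⌢-irrefl

  -- The map is total and constrained on `P` only, so that adding a vertex changes a single value.
  -- Blue is expressed as the absence of red adjacency.
  record Embeds (P : List (Fin p)) (W : List (Fin N)) : Set where
    field
      f         : Fin p → Fin N
      into      : ∀ {x} → x ∈ P → f x ∈ W
      injective : ∀ {x y} → x ∈ P → y ∈ P → f x ≡ f y → x ≡ y
      blue-edge : ∀ {x y} → x ∈ P → y ∈ P → x ⌢ y → ¬ (f x ~ f y)

  Embeds-resp : ∀ {P P′ W W′} → (∀ {x} → x ∈ P′ → x ∈ P) → (∀ {y} → y ∈ W → y ∈ W′) →
    Embeds P W → Embeds P′ W′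
  Embeds-resp P′⊆ W⊆ e = record
    { f = f ; into = W⊆ ∘ into ∘ P′⊆ ; injective = λ x∈ y∈ → injective (P′⊆ x∈) (P′⊆ y∈)
    ; blue-edge = λ x∈ y∈ → blue-edge (P′⊆ x∈) (P′⊆ y∈) }
    where
    open Embeds e

  -- The forbidden places are the images of `P` and the red neighbours in `W` of the images of
  -- neighbours of `x`. There are at most X of the latter, since each of the δ neighbours
  -- contributes at most X / δ.
  extend : ∀ {x P W} X → Unique (x ∷ P) → Unique W → Embeds P W →
    (∀ {y} → y ∈ W → H.degree P x * R.degree W y ≤ X) → length P + X < length W → Embeds (x ∷ P) W
  extend {x} {P} {W} X (x∉ ∷ uP) uW e bound room = record
    { f = g ; into = into′ ; injective = injective′ ; blue-edge = blue′ }
    where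
    open Embeds e
    nb = filter (x ⌢?_) P
    redOf : Fin p → List (Fin N)
    redOf i = filter (f i ~?_) W
    taken = map f P ++ concatMap redOf nb
    |taken| : length taken ≤ length P + X
    |taken| = begin
      length taken                                   ≡⟨ length-++ (map f P) ⟩
      length (map f P) + length (concatMap redOf nb) ≡⟨ cong₂ _+_ (length-map f P) (length-concatMap redOf nb) ⟩
      length P + Σ[ nb ] (R.degree W ∘ f)            ≤⟨ +-monoʳ-≤ (length P) (Σ-length-scaled nb
                                                          (bound ∘ into ∘ proj₁ ∘ ∈-filter⁻ (x ⌢?_))) ⟩
      length P + X                                   ∎
      where
      open ≤-Reasoning
    new : ∃ λ y → y ∈ W × y ∉ taken
    new = fresh Fin._≟_ uW (≤-<-trans |taken| room)
    y = proj₁ new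
    y∈W = proj₁ (proj₂ new)
    y∉f : ∀ {i} → i ∈ P → f i ≢ y
    y∉f i∈ e = proj₂ (proj₂ new) (∈-++⁺ˡ (subst (_∈ map f P) e (∈-map⁺ f i∈)))
    y≁ : ∀ {i} → i ∈ P → x ⌢ i → ¬ (f i ~ y)
    y≁ i∈ xi fi~y = proj₂ (proj₂ new) (∈-++⁺ʳ (map f P)
      (∈-concatMap⁺ redOf (lose (∈-filter⁺ (x ⌢?_) i∈ xi) (∈-filter⁺ _ y∈W fi~y))))
    g : Fin p → Fin N
    g i with i Fin.≟ x
    ... | yes _ = y
    ... | no  _ = f i
    gx : g x ≡ y
    gx with x Fin.≟ x
    ... | yes _ = refl
    ... | no ne = ⊥-elim (ne refl)
    gP : ∀ {i} → i ∈ P → g i ≡ f i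
    gP {i} i∈ with i Fin.≟ x
    ... | yes refl = ⊥-elim (All.lookup x∉ i∈ refl)
    ... | no _ = refl
    into′ : ∀ {i} → i ∈ x ∷ P → g i ∈ W
    into′ (here refl) = subst (_∈ W) (sym gx) y∈W
    into′ (there i∈)  = subst (_∈ W) (sym (gP i∈)) (into i∈)
    injective′ : ∀ {i k} → i ∈ x ∷ P → k ∈ x ∷ P → g i ≡ g k → i ≡ k
    injective′ (here refl) (here refl) _ = refl
    injective′ (here refl) (there k∈) q = ⊥-elim (y∉f k∈ (trans (sym (gP k∈)) (trans (sym q) gx)))
    injective′ (there i∈) (here refl) q = ⊥-elim (y∉f i∈ (trans (sym (gP i∈)) (trans q gx)))
    injective′ (there i∈) (there k∈) q = injective i∈ k∈ (trans (sym (gP i∈)) (trans q (gP k∈)))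
    blue′ : ∀ {i k} → i ∈ x ∷ P → k ∈ x ∷ P → i ⌢ k → ¬ (g i ~ g k)
    blue′ (here refl) (here refl) ik = ⊥-elim (⌢-irrefl ik)
    blue′ (here refl) (there k∈) ik r = y≁ k∈ ik (~-sym (subst₂ _~_ gx (gP k∈) r))
    blue′ (there i∈) (here refl) ik r = y≁ i∈ (⌢-sym ik) (subst₂ _~_ (gP i∈) gx r)
    blue′ (there i∈) (there k∈) ik r = blue-edge i∈ k∈ ik (subst₂ _~_ (gP i∈) (gP k∈) r)

  embeds-[] : Fin N → ∀ {W} → Embeds [] W
  embeds-[] v = record { f = λ _ → v ; into = λ () ; injective = λ () ; blue-edge = λ () }

  -- A graph of size m is √(2m)-degenerate.
  embeds-low-degree : Fin N → ∀ {Q D e W} → e ≤ Q * Q → Unique W → (∀ {y} → y ∈ W → R.degree W y ≤ D) →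
    ∀ n P → length P ≡ n → Unique P → H.degreeSum P ≤ e → n + Q * D ≤ length W → Embeds P W
  embeds-low-degree v _ _ _ _ [] _ _ _ _ = embeds-[] v
  embeds-low-degree v {Q} {D} {e} {W} e≤ uW low (suc n) (x₀ ∷ P₀) len uP sum≤ room =
    Embeds-resp (∈-resp-↭ π) (λ y∈ → y∈) (extend (Q * D) uxP uW
      (embeds-low-degree v {Q} e≤ uW low n P |P| (AllPairs.tail uxP) (≤-trans dec sum≤) (<⇒≤ room))
      (λ y∈ → *-mono-≤ δ≤Q (low y∈))
      (subst (λ l → l + Q * D < length W) (sym |P|) room))
    where
    open ≤-Reasoning
    below = H.remove-below-average x₀ P₀
    x = proj₁ below
    P = proj₁ (proj₂ below)
    π = proj₁ (proj₂ (proj₂ below))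
    avg = proj₁ (proj₂ (proj₂ (proj₂ below)))
    dec = proj₂ (proj₂ (proj₂ (proj₂ below)))
    uxP : Unique (x ∷ P)
    uxP = Unique-↭ π uP
    |P| : length P ≡ n
    |P| = trans (sym (suc-injective (↭-length π))) (suc-injective len)
    δ = H.degree P x
    -- The degree is at most the number of vertices, so its square is at most the degree sum.
    δ≤Q : δ ≤ Q
    δ≤Q = ≮⇒≥ λ Q<δ → <⇒≱ (*-mono-< Q<δ Q<δ) (begin
      δ * δ                              ≤⟨ *-monoˡ-≤ δ (m≤n⇒m≤1+n (length-filter _ P)) ⟩
      suc (length P) * δ                 ≤⟨ ≤-trans avg sum≤ ⟩
      e                                  ≤⟨ e≤ ⟩
      Q * Q                              ∎)

  all : List (Fin N)
  all = allFin N

  |all| : length all ≡ N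
  |all| = length-tabulate (λ i → i)

  copy : Embeds (allFin p) all → HasCopy c blue G
  copy e = f , injective (∈-allFin _) (∈-allFin _) , λ x y xy →
    Bool.¬-not λ red-edge → blue-edge (∈-allFin x) (∈-allFin y) xy
      ((λ q → ⌢-irrefl (subst (_⌢ y) (injective (∈-allFin x) (∈-allFin y) q) xy)) , red-edge)
    where
    open Embeds e

  -- The induction on the vertices of `G`

  -- To be read with d the size of a neighbourhood and w, g its numbers of vertices of low and
  -- high degree.
  room-in-neighbourhood : ∀ a e E δ n d w g QD → 1 ≤ a → n * δ ≤ e → e + E < δ * d → d ≡ w + g →
    g * (2 * a) ≤ d → e + 2 * a * (δ * QD) < a * E → n + QD ≤ w
  room-in-neighbourhood (suc b) e E δ n d w g QD _ nδ big refl few gap =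
    ≮⇒≥ λ w< → <⇒≱ gap (+-cancelˡ-≤ ((a + b) * e) _ _ (begin
      -- The factor `a + b` is 2a - 1: at most one vertex in 2a has high degree, so (2a - 1) d ≤ 2a
      -- w.
      (a + b) * e + a * E                       ≤⟨ +-monoʳ-≤ ((a + b) * e) (*-monoˡ-≤ E (m≤m+n a b)) ⟩
      (a + b) * e + (a + b) * E                 ≡⟨ *-distribˡ-+ (a + b) e E ⟨
      (a + b) * (e + E)                         ≤⟨ *-monoʳ-≤ (a + b) (<⇒≤ big) ⟩
      (a + b) * (δ * (w + g))                   ≤⟨ +-cancelˡ-≤ (δ * (w + g)) _ _ (step w<) ⟩
      2 * a * (e + δ * QD)                      ≡⟨ solve 3 (λ b e x → con 2 :* (con 1 :+ b) :* (e :+ x) :=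
                                                     (con 1 :+ b :+ b) :* e :+ (e :+ con 2 :* (con 1 :+ b) :* x)) refl b e (δ * QD) ⟩
      (a + b) * e + (e + 2 * a * (δ * QD))      ∎))
    where
    open ≤-Reasoning
    open +-*-Solver
    a = suc b
    step : w < n + QD → δ * (w + g) + (a + b) * (δ * (w + g)) ≤ δ * (w + g) + 2 * a * (e + δ * QD)
    step w< = begin
      δ * (w + g) + (a + b) * (δ * (w + g))            ≡⟨ solve 4 (λ b δ w g → δ :* (w :+ g) :+ (con 1 :+ b :+ b) :* (δ :* (w :+ g)) :=
                                                            δ :* (g :* (con 2 :* (con 1 :+ b)) :+ con 2 :* (con 1 :+ b) :* w)) refl b δ w g ⟩
      δ * (g * (2 * a) + 2 * a * w)                    ≤⟨ *-monoʳ-≤ δ (+-mono-≤ few (*-monoʳ-≤ (2 * a) (<⇒≤ w<))) ⟩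
      δ * (w + g + 2 * a * (n + QD))                   ≡⟨ solve 5 (λ δ d t n q → δ :* (d :+ t :* (n :+ q)) :=
                                                            δ :* d :+ t :* (n :* δ :+ δ :* q)) refl δ (w + g) (2 * a) n QD ⟩
      δ * (w + g) + 2 * a * (n * δ + δ * QD)           ≤⟨ +-monoʳ-≤ (δ * (w + g)) (*-monoʳ-≤ (2 * a) (+-monoˡ-≤ (δ * QD) nδ)) ⟩
      δ * (w + g) + 2 * a * (e + δ * QD)               ∎

  -- The numerical requirements are kept abstract: `s * s` separates small parts from large ones,
  -- `Q` bounds the degeneracy, and `gap` leaves room in a red neighbourhood.
  module Main (v : Fin N) {a e E s Q : ℕ} (1≤a : 1 ≤ a) (size≤ : H.degreeSum (allFin p) ≤ e)
    (N≥sum : e + p + E ≤ N) (N≥clique : T * (T * s + 2) * (s * s) ≤ N) (e≤Q² : e ≤ Q * Q)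
    (gap : ∀ {δ} → s * s * δ ≤ e → e + 2 * a * (δ * (Q * (T * (2 * a)))) < a * E) where

    M : ℕ
    M = T * (T * s + 2)

    -- A red-independent set is a blue clique, so the greedy embedding applies with red degree bound
    -- 0.
    embeds-small : ∀ {n P} → length P ≡ n → Unique P → H.degreeSum P ≤ e → n ≤ s * s → Cycle ⊎ Embeds P all
    embeds-small {n} {P} |P| uP sum≤ n≤ with independent-or-cycle n s n≤ N all (≤-reflexive |all|) (Unique.allFin⁺ N)
    ... | inj₁ cyc = inj₁ cyc
    ... | inj₂ (I , bound) = inj₂ (Embeds-resp (λ x∈ → x∈) (λ _ → ∈-allFin _)
      (embeds-low-degree v {Q} {0} e≤Q² (unique I) isolated n P |P| uP sum≤
        (≤-trans (≤-reflexive (trans (cong (n +_) (*-zeroʳ Q)) (+-identityʳ n))) n≤I)))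
      where
      isolated : ∀ {y} → y ∈ elems I → R.degree (elems I) y ≤ 0
      isolated {y} y∈ = ≤-reflexive (cong length (filter-none (y ~?_) (All.tabulate (indep I y∈))))
      n≤I : n ≤ size I
      n≤I = [ (λ le → le) , (λ le → *-cancelˡ-≤ M {{M≢0}}
              (≤-trans (*-monoʳ-≤ M n≤) (≤-trans N≥clique (≤-trans (≤-reflexive (sym |all|)) le)))) ]′ bound
        where
        M≢0 : NonZero M
        M≢0 = m*n≢0 T (T * s + 2) {{_}} {{>-nonZero (≤-trans (s≤s z≤n) (m≤n+m 2 (T * s)))}}

    -- If some red degree is too large for `x` to be placed safely, the given embedding of `P` is
    -- abandoned and all of `x ∷ P` is embedded anew inside that red neighbourhood.
    extend-or-neighbourhood : ∀ {x P n} → Unique (x ∷ P) → suc (length P) ≡ n → n ≤ p → H.degreeSum (x ∷ P) ≤ e →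
      n * H.degree P x ≤ e → s * s ≤ n → Embeds P all → Cycle ⊎ Embeds (x ∷ P) all
    extend-or-neighbourhood {x} {P} {n} u |P| n≤p sum≤ nδ≤e large emb =
      decide (any? (λ y → e + E <? δ * R.degree all y) all)
      where
      δ = H.degree P x
      module _ (y : Fin N) (big : e + E < δ * R.degree all y) where
        -- The average degree in `W` is at most `T`, so by Markov's inequality at most one vertex in
        -- 2a exceeds `D`.
        D = T * (2 * a)
        W = filter (y ~?_) all
        uW : Unique W
        uW = Unique.filter⁺ (y ~?_) (Unique.allFin⁺ N)
        low? : Decidable (λ z → R.degree W z ≤ D)
        low? z = R.degree W z ≤? D
        W′ = filter low? W
        uW′ : Unique W′
        uW′ = Unique.filter⁺ low? uW
        low : ∀ {z} → z ∈ W′ → R.degree W′ z ≤ D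
        low {z} z∈ = ≤-trans (length-mono {xs = filter (z ~?_) W′} {filter (z ~?_) W} (Unique.filter⁺ (z ~?_) uW′)
          (λ t∈ → let t∈W′ , z~t = ∈-filter⁻ (z ~?_) {xs = W′} t∈ in
                  ∈-filter⁺ (z ~?_) (proj₁ (∈-filter⁻ low? {xs = W} t∈W′)) z~t))
          (proj₂ (∈-filter⁻ low? {xs = W} z∈))
        high = length (filter (¬? ∘ low?) W)
        few : R.degreeSum W ≤ T * length W → high * (2 * a) ≤ length W
        few sparse = *-cancelˡ-≤ T (begin
          T * (high * (2 * a))       ≡⟨ solve 3 (λ t g b → t :* (g :* b) := g :* (t :* b)) refl T high (2 * a) ⟩
          high * D                   ≤⟨ markov (¬? ∘ low?) W (<⇒≤ ∘ ≰⇒>) ⟩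
          R.degreeSum W              ≤⟨ sparse ⟩
          T * length W               ∎)
          where
          open ≤-Reasoning
          open +-*-Solver
        room : R.degreeSum W ≤ T * length W → n + Q * D ≤ length W′
        room sparse = room-in-neighbourhood a e E δ n (length W) (length W′) high (Q * D) 1≤a nδ≤e big
          (length-filter-split low? W) (few sparse) (gap (≤-trans (*-monoˡ-≤ δ large) nδ≤e))
        embed-in-neighbourhood : Cycle ⊎ Embeds (x ∷ P) all
        embed-in-neighbourhood = map₂ (λ sparse → Embeds-resp (λ z∈ → z∈) (λ _ → ∈-allFin _)
          (embeds-low-degree v {Q} {D} e≤Q² uW′ low n (x ∷ P) |P| u sum≤ (room sparse)))
          (neighbourhood-sparse y (length W) W ≤-refl uW (All.all-filter (y ~?_) all))
      open ≤-Reasoning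
      decide : Dec (Any (λ y → e + E < δ * R.degree all y) all) → Cycle ⊎ Embeds (x ∷ P) all
      decide (yes q) = let y , _ , big = find q in embed-in-neighbourhood y big
      decide (no ¬q) = inj₂ (extend (e + E) u (Unique.allFin⁺ N) emb
        (λ y∈ → ≮⇒≥ (All.lookup (All.¬Any⇒All¬ all ¬q) y∈)) (begin
          suc (length P) + (e + E)      ≡⟨ cong (_+ (e + E)) |P| ⟩
          n + (e + E)                   ≤⟨ +-monoˡ-≤ (e + E) n≤p ⟩
          p + (e + E)                   ≡⟨ trans (sym (+-assoc p e E)) (cong (_+ E) (+-comm p e)) ⟩
          e + p + E                     ≤⟨ N≥sum ⟩
          N                             ≡⟨ |all| ⟨
          length all                    ∎))

    embeds-or-cycle : ∀ n P → length P ≡ n → Unique P → H.degreeSum P ≤ e → n ≤ p → Cycle ⊎ Embeds P all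
    embeds-or-cycle _ [] _ _ _ _ = inj₂ (embeds-[] v)
    embeds-or-cycle (suc n) P@(x₀ ∷ P₀) |P| uP sum≤ n<p with suc n ≤? s * s
    ... | yes small = embeds-small |P| uP sum≤ small
    ... | no large =
      [ inj₁ , map₂ (Embeds-resp (∈-resp-↭ π) (λ y∈ → y∈)) ∘
               extend-or-neighbourhood uP′ |xP′| n<p (≤-trans (≤-reflexive (sym (H.degreeSum-↭ π))) sum≤)
                 (≤-trans (≤-reflexive (cong (_* H.degree P′ x) (sym |xP′|))) (≤-trans avg sum≤)) (<⇒≤ (≰⇒> large)) ]′
        (embeds-or-cycle n P′ (suc-injective |xP′|) (AllPairs.tail uP′) (≤-trans dec sum≤) (<⇒≤ n<p))
      where
      below = H.remove-below-average x₀ P₀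
      x = proj₁ below
      P′ = proj₁ (proj₂ below)
      π = proj₁ (proj₂ (proj₂ below))
      avg = proj₁ (proj₂ (proj₂ (proj₂ below)))
      dec = proj₂ (proj₂ (proj₂ (proj₂ below)))
      uP′ : Unique (x ∷ P′)
      uP′ = Unique-↭ π uP
      |xP′| : suc (length P′) ≡ suc n
      |xP′| = trans (sym (↭-length π)) |P|

-- The handshake lemma

𝟙 : Bool → ℕ
𝟙 true  = 1
𝟙 false = 0

length-filterᵇ : ∀ (f : A → Bool) xs → length (filterᵇ f xs) ≡ Σ[ xs ] (𝟙 ∘ f)
length-filterᵇ f []       = refl
length-filterᵇ f (x ∷ xs) with f x
... | true  = cong suc (length-filterᵇ f xs)
... | false = length-filterᵇ f xs

length-filter-true : ∀ (f : A → Bool) xs → length (filter (λ x → f x Bool.≟ true) xs) ≡ Σ[ xs ] (𝟙 ∘ f)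
length-filter-true f []       = refl
length-filter-true f (x ∷ xs) with f x
... | true  = cong suc (length-filter-true f xs)
... | false = length-filter-true f xs

Σ-cartesianProduct : ∀ {B : Set} (xs : List A) (ys : List B) h →
  Σ[ cartesianProduct xs ys ] h ≡ Σ[ xs ] λ x → Σ[ ys ] λ y → h (x , y)
Σ-cartesianProduct []       ys h = refl
Σ-cartesianProduct (x ∷ xs) ys h =
  trans (cong sum (map-++ h (map (x ,_) ys) _))
  (trans (sum-++ (map h (map (x ,_) ys)) _)
  (cong₂ _+_ (cong sum (sym (map-∘ ys))) (Σ-cartesianProduct xs ys h)))

-- Each adjacent pair is charged to the order in which it increases, the one that `edgeCount`
-- counts; exchanging the two sums identifies both halves.
handshake : ∀ {p} (G : SimpleGraph p) →
  Σ[ allFin p ] (λ i → length (filter (λ k → Adj G i k Bool.≟ true) (allFin p))) ≤ 2 * edgeCount G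
handshake {p} G = begin
  Σ[ V ] (λ i → length (filter (λ k → Adj G i k Bool.≟ true) V))   ≤⟨ Σ-mono V (λ {i} _ → ≤-trans
                                                                        (≤-reflexive (length-filter-true (Adj G i) V)) (Σ-mono V λ {k} _ → split i k)) ⟩
  Σ[ V ] (λ i → Σ[ V ] λ k → up i k + up k i)                      ≤⟨ Σ-mono V (λ {i} _ → ≤-reflexive (Σ-+ V (up i) _)) ⟩
  Σ[ V ] (λ i → Σ[ V ] (up i) + Σ[ V ] λ k → up k i)               ≡⟨ Σ-+ V _ _ ⟩
  Σ[ V ] (λ i → Σ[ V ] (up i)) + Σ[ V ] (λ i → Σ[ V ] λ k → up k i) ≡⟨ cong (m′ +_) (Σ-swap V V up) ⟨
  m′ + m′                                                          ≡⟨ cong₂ _+_ count (trans count (sym (+-identityʳ _))) ⟩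
  2 * edgeCount G                                                  ∎
  where
  open ≤-Reasoning
  V = allFin p
  up : Fin p → Fin p → ℕ
  up i k = 𝟙 ((toℕ i <ᵇ toℕ k) ∧ Adj G i k)
  m′ = Σ[ V ] (λ i → Σ[ V ] (up i))
  count : m′ ≡ edgeCount G
  count = sym (trans (length-filterᵇ _ (cartesianProduct V V)) (Σ-cartesianProduct V V _))
  split : ∀ i k → 𝟙 (Adj G i k) ≤ up i k + up k i
  split i k with Fin.<-cmp i k
  ... | B.tri< i<k _ _ rewrite Equivalence.to Bool.T-≡ (<⇒<ᵇ i<k) = m≤m+n _ _
  ... | B.tri≈ _ refl _ rewrite irrefl G i = z≤n
  ... | B.tri> _ _ k<i rewrite Equivalence.to Bool.T-≡ (<⇒<ᵇ k<i) | SimpleGraph.sym G i k = m≤n+m _ _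

-- Integer roots and the choice of parameters

floor-root : ∀ r .{{_ : NonZero r}} m → 1 ≤ m → ∃ λ a → 1 ≤ a × a ^ r ≤ m × m < suc a ^ r
floor-root r (suc zero) _ = 1 , ≤-refl , ≤-reflexive (^-zeroˡ r) , subst (_< 2 ^ r) (^-zeroˡ r) (^-monoˡ-< r (n<1+n 1))
floor-root r (suc m@(suc _)) _ with a , 1≤a , lo , hi ← floor-root r m (s≤s z≤n) | suc a ^ r ≤? suc m
... | yes le = suc a , s≤s z≤n , le , ≤-<-trans hi (^-monoˡ-< r (n<1+n (suc a)))
... | no gt  = a , 1≤a , m≤n⇒m≤1+n lo , ≰⇒> gt

^-distribʳ-* : ∀ r m n → (m * n) ^ r ≡ m ^ r * n ^ r
^-distribʳ-* zero    m n = refl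
^-distribʳ-* (suc r) m n = trans (cong (m * n *_) (^-distribʳ-* r m n)) ([m*n]*[o*p]≡[m*o]*[n*p] m n (m ^ r) (n ^ r))

approximate-root : ∀ r .{{_ : NonZero r}} m Z → 1 ≤ m → 2 ^ r ≤ Z → ∃ λ a → 1 ≤ a × a ^ r ≤ m × m ≤ Z * a ^ r
approximate-root r m Z 1≤m 2^r≤Z with a , 1≤a , lo , hi ← floor-root r m 1≤m = a , 1≤a , lo , (begin
  m                ≤⟨ <⇒≤ hi ⟩
  suc a ^ r        ≤⟨ ^-monoˡ-≤ r (+-monoˡ-≤ a 1≤a) ⟩
  (a + a) ^ r      ≡⟨ cong (λ b → (a + b) ^ r) (+-identityʳ a) ⟨
  (2 * a) ^ r      ≡⟨ ^-distribʳ-* r 2 a ⟩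
  2 ^ r * a ^ r    ≤⟨ *-monoˡ-≤ (a ^ r) 2^r≤Z ⟩
  Z * a ^ r        ∎)
  where
  open ≤-Reasoning

-- With a of order m^(1/20), the clique case costs about s^3 = a^18, below `E`. A large part has δ
-- of order at most a^20 / a^12 = a^8 and degeneracy of order at most a^10, so the loss 2a δ Q D is
-- of order a^20, the same as a E; the constant C decides.
module Exponents {Z T C m : ℕ} (1≤Z : 1 ≤ Z) (clique≤C : T * (T + 2) ≤ C) (gap<C : 2 * Z + 16 * (Z * Z) * T < C)
  (a : ℕ) (1≤a : 1 ≤ a) (m≤ : m ≤ Z * a ^ 20) where
  s Q E : ℕ
  s = a ^ 6
  Q = 2 * Z * a ^ 10
  E = C * a ^ 19

  open ≤-Reasoning
  open +-*-Solver

  instance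
    a≢0 : NonZero a
    a≢0 = >-nonZero 1≤a

  1≤s : 1 ≤ s
  1≤s = >-nonZero⁻¹ s {{m^n≢0 a 6}}

  2m≤ : 2 * m ≤ 2 * Z * a ^ 20
  2m≤ = ≤-trans (*-monoʳ-≤ 2 m≤) (≤-reflexive (sym (*-assoc 2 Z (a ^ 20))))

  clique : T * (T * s + 2) * (s * s) ≤ E
  clique = begin
    T * (T * s + 2) * (s * s)             ≤⟨ *-monoˡ-≤ (s * s) (*-monoʳ-≤ T (+-monoʳ-≤ (T * s) (*-monoʳ-≤ 2 1≤s))) ⟩
    T * (T * s + 2 * s) * (s * s)         ≡⟨ solve 2 (λ t s →
        t :* (t :* s :+ con 2 :* s) :* (s :* s) := t :* (t :+ con 2) :* (s :* (s :* s))) refl T s ⟩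
    T * (T + 2) * (s * (s * s))           ≤⟨ *-mono-≤ clique≤C (m≤n*m (s * (s * s)) a) ⟩
    C * (a * (s * (s * s)))               ≡⟨ cong (C *_) (solve 1 (λ a → a :* (a :^ 6 :* (a :^ 6 :* a :^ 6)) := a :^ 19) refl a) ⟩
    E                                     ∎

  2m≤Q² : 2 * m ≤ Q * Q
  2m≤Q² = begin
    2 * m                                 ≤⟨ 2m≤ ⟩
    2 * Z * a ^ 20                        ≤⟨ m≤n*m _ (2 * Z) {{m*n≢0 2 Z {{_}} {{>-nonZero 1≤Z}}}} ⟩
    2 * Z * (2 * Z * a ^ 20)              ≡⟨ cong (λ b → 2 * Z * (2 * Z * b)) (^-distribˡ-+-* a 10 10) ⟩
    2 * Z * (2 * Z * (a ^ 10 * a ^ 10))   ≡⟨ solve 2 (λ z b → z :* (z :* (b :* b)) := z :* b :* (z :* b)) refl (2 * Z) (a ^ 10) ⟩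
    Q * Q                                 ∎

  gap : ∀ {δ} → s * s * δ ≤ 2 * m → 2 * m + 2 * a * (δ * (Q * (T * (2 * a)))) < a * E
  gap {δ} sδ≤ = begin-strict
    2 * m + 2 * a * (δ * (Q * (T * (2 * a))))                                ≤⟨ +-mono-≤ 2m≤ (*-monoʳ-≤ (2 * a) (*-monoˡ-≤ _ δ≤)) ⟩
    2 * Z * a ^ 20 + 2 * a * (2 * Z * a ^ 8 * (2 * Z * a ^ 10 * (T * (2 * a)))) ≡⟨ solve 3 (λ z t a →
        con 2 :* z :* a :^ 20 :+ con 2 :* a :* (con 2 :* z :* a :^ 8 :* (con 2 :* z :* a :^ 10 :* (t :* (con 2 :* a)))) :=
        (con 2 :* z :+ con 16 :* (z :* z) :* t) :* a :^ 20) refl Z T a ⟩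
    (2 * Z + 16 * (Z * Z) * T) * a ^ 20                                      <⟨ *-monoˡ-< (a ^ 20) {{m^n≢0 a 20}} gap<C ⟩
    C * a ^ 20                                                               ≡⟨ solve 2 (λ c a → c :* a :^ 20 := a :* (c :* a :^ 19)) refl C a ⟩
    a * E                                                                    ∎
    where
    δ≤ : δ ≤ 2 * Z * a ^ 8
    δ≤ = *-cancelˡ-≤ (s * s) {{m*n≢0 s s {{m^n≢0 a 6}} {{m^n≢0 a 6}}}} (≤-trans sδ≤ (≤-trans 2m≤ (≤-reflexive
      (solve 2 (λ z a → z :* a :^ 20 := a :^ 6 :* a :^ 6 :* (z :* a :^ 8)) refl (2 * Z) a))))

  power : a ^ 20 ≤ m → E ^ 20 ≤ C ^ 20 * m ^ 19
  power lo = begin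
    (C * a ^ 19) ^ 20            ≡⟨ ^-distribʳ-* 20 C (a ^ 19) ⟩
    C ^ 20 * (a ^ 19) ^ 20       ≡⟨ cong (C ^ 20 *_) (trans (^-*-assoc a 19 20) (sym (^-*-assoc a 20 19))) ⟩
    C ^ 20 * (a ^ 20) ^ 19       ≤⟨ *-monoʳ-≤ (C ^ 20) (^-monoˡ-≤ 19 lo) ⟩
    C ^ 20 * m ^ 19              ∎

-- The error term C m^(19/20) is compared through twentieth powers, which keeps the bound within
-- natural numbers. Any such N bounds the least one.
RamseyWithin : ℕ → ℕ → ∀ {p} → SimpleGraph p → Set
RamseyWithin j C {p} G = ∃ λ N → 1 ≤ N ×
  (∀ (c : Colouring N) → SymmetricColouring c → HasCycleCopy c red (4 + j) ⊎ HasCopy c blue G) ×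
  (N ∸ (2 * edgeCount G + p)) ^ 20 ≤ C ^ 20 * edgeCount G ^ 19

-- Assembly of the bound

module Bound (Z C j : ℕ) (1≤Z : 1 ≤ Z) (clique≤C : 2 * (4 + j) * (2 * (4 + j) + 2) ≤ C)
  (gap<C : 2 * Z + 16 * (Z * Z) * (2 * (4 + j)) < C) where

  bound-from-root : ∀ {p} (G : SimpleGraph p) a →
    1 ≤ edgeCount G → 1 ≤ a → a ^ 20 ≤ edgeCount G → edgeCount G ≤ Z * a ^ 20 →
    RamseyWithin j C G
  bound-from-root {p} G a 1≤m 1≤a lo hi = N , 1≤N , ramsey ,
    subst (λ x → x ^ 20 ≤ C ^ 20 * m ^ 19) (sym (m+n∸m≡n (2 * m + p) E)) (power lo)
    where
    m = edgeCount G
    open Exponents {Z} {2 * (4 + j)} {C} {m} 1≤Z clique≤C gap<C a 1≤a hi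
    N = 2 * m + p + E
    1≤N : 1 ≤ N
    1≤N = ≤-trans 1≤m (≤-trans (m≤m+n m _) (≤-trans (m≤m+n (2 * m) p) (m≤m+n (2 * m + p) E)))
    ramsey : ∀ (c : Colouring N) → SymmetricColouring c → HasCycleCopy c red (4 + j) ⊎ HasCopy c blue G
    ramsey c c-sym = map₂ copy (embeds-or-cycle p (allFin p) (length-tabulate (λ i → i))
        (Unique.allFin⁺ p) (handshake G) ≤-refl)
      where
      open Embedding c c-sym j G
      open Main (fromℕ< 1≤N) {a} {2 * m} {E} {s} {Q} 1≤a (handshake G) ≤-refl
        (≤-trans clique (m≤n+m E (2 * m + p))) 2m≤Q² gap

-- Z is a variable although only 2 ^ 20 is needed: the closed numeral would be unfolded.
ramsey-bound : ∀ Z j → 2 ^ 20 ≤ Z → ∃ λ B → ∀ p (G : SimpleGraph p) → 1 ≤ edgeCount G → RamseyWithin j (2 * B) G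
ramsey-bound Z j 2^20≤Z = B , λ p G 1≤m → from G 1≤m (approximate-root 20 (edgeCount G) Z 1≤m 2^20≤Z)
  where
  T B : ℕ
  T = 2 * (4 + j)
  -- The summands meet the requirements `clique≤C` and `gap<C`; the successor makes the second
  -- strict.
  B = T * (T + 2) + suc (2 * Z + 16 * (Z * Z) * T)
  open Bound Z (2 * B) j (≤-trans (m^n>0 2 20) 2^20≤Z)
    (≤-trans (m≤m+n (T * (T + 2)) (suc (2 * Z + 16 * (Z * Z) * T))) (m≤n*m B 2))
    (≤-trans (m≤n+m (suc (2 * Z + 16 * (Z * Z) * T)) (T * (T + 2))) (m≤n*m B 2))
  from : ∀ {p} (G : SimpleGraph p) → 1 ≤ edgeCount G →
    (∃ λ a → 1 ≤ a × a ^ 20 ≤ edgeCount G × edgeCount G ≤ Z * a ^ 20) → RamseyWithin j (2 * B) G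
  from G 1≤m (a , 1≤a , lo , hi) = bound-from-root G a 1≤m 1≤a lo hi

theorem2 : ∀ (k : ℕ) → 2 ≤ k →
    ∃ λ (B : ℕ) → ∀ (p : ℕ) (G : SimpleGraph p) →
    NoIsolatedVertices G → 1 ≤ edgeCount G →
    ∃ λ (N : ℕ) → 1 ≤ N × RamseyProp k G N ×
    (N ∸ (2 * edgeCount G + p)) ^ 20 ≤ (2 * B) ^ 20 * edgeCount G ^ 19
theorem2 k 2≤k =
  let B , bound = ramsey-bound (2 ^ 20) (2 * k ∸ 4) ≤-refl in
  B , λ p G _ 1≤m →
    let N , 1≤N , ramsey , excess = bound p G 1≤m in
    N , 1≤N , (λ c c-sym → map₁ (subst (HasCycleCopy c red) (m+[n∸m]≡n (*-monoʳ-≤ 2 2≤k))) (ramsey c c-sym)) , excess
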